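{- Let $t=[p_1,p_2,p_3,p_4]\in L^4$ be a legitimate quadruple and let $l\in L$ be such that either $l=0$ or $l\in L^*\setminus(L^*)^{\sigma-1}$. Then $B(2,m,s,l,t)$ is a presemifield of order $2^{2m}$.
   Context: A (finite) presemifield is a finite additive abelian group with a multiplication that is distributive on both sides over addition and has no zero divisors. Let $m\ge 1$, $F=GF(2^{2m})\supset L=GF(2^m)$, $0\le s<2m$ an integer, $\sigma=2^s$ (so $u^\sigma=u^{2^s}$), and $(L^*)^{\sigma-1}=\{u^{\sigma-1}: u\in L^*\}$. Fix $\mu\in L$ of absolute trace $1$ and $z\in F$ with $z^2+z=\mu$; then $1,z$ is a basis of $F$ over $L$ and we write $(a,b)=a+bz$ for $a,b\in L$. A quadruple $t=[p_1,p_2,p_3,p_4]\in L^4$ is legitimate if the polynomial $p_{s,t}(X)=p_1X^{\sigma+1}+p_2X^{\sigma}+p_3X+p_4$ has no roots in $L$. $B(2,m,s,l,t)$ denotes the additive group of $F$ with the multiplication given, for $x=(a,b)$, $y=(c,d)$, by $$x\circ y=(p_1ac^{\sigma}+lp_1a^{\sigma}c+p_2bc^{\sigma}+lp_2a^{\sigma}d+p_3ad^{\sigma}+lp_3b^{\sigma}c+p_4bd^{\sigma}+lp_4b^{\sigma}d,\ ad+bc).$$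
   Formalization: The formal theorem adds the hypothesis p_1 ≠ 0; without it the claim is false, since t=[0,0,0,1] is legitimate and p_1=0 always gives (1,0)∘(1,0)=(0,0). -}

module Defs where

open import Level using (Level; _⊔_) renaming (suc to lsuc)
open import Algebra.Bundles using (CommutativeMonoid; CommutativeRing; RawRingWithoutOne)
open import Algebra.Morphism.Structures using (IsRingMonomorphism)
open import Algebra.Structures using (IsAbelianGroup)
import Algebra.Definitions as AlgebraDefinitions
import Algebra.Properties.AbelianGroup as AbelianGroupProperties
import Algebra.Properties.CommutativeMonoid.Sum as Sum
import Algebra.Properties.CommutativeSemigroup as CommutativeSemigroupProperties
import Algebra.Properties.CommutativeSemiring.Exp as Exp
import Algebra.Properties.Semiring.Mult as Mult
open import Data.Empty using (⊥-elim)
open import Data.Fin.Base using (Fin; toℕ; cast; combine; punchIn; punchOut; remQuot)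
  renaming (zero to fzero; suc to fsuc)
open import Data.Fin.Permutation using (Permutation; permutation)
open import Data.Fin.Properties using (any?; cast-involutive; combine-remQuot; injective⇒≤;
  punchInᵢ≢i; punchOut-injective)
  renaming (_≟_ to _≟ᶠ_)
open import Data.Nat.Base as ℕ using (ℕ; zero; suc)
import Data.Nat.Properties as ℕₚ
open import Data.Product.Base using (∃; Σ-syntax; ∃-syntax; _×_; _,_; proj₁; proj₂)
open import Data.Sum.Base using (_⊎_; inj₁; inj₂)
open import Function.Base using (_∘_)
open import Function.Bundles using (Inverse)
open import Function.Definitions using (Injective)
open import Relation.Binary.Bundles using (Setoid)
open import Relation.Binary.PropositionalEquality as ≡ using (_≡_; _≢_)
import Relation.Binary.Reasoning.Setoid as SetoidReasoning
open import Relation.Nullary using (¬_; Dec; yes; no)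
open import Relation.Nullary.Decidable using (map′)

HasOrder : ∀ {c ℓ} → Setoid c ℓ → ℕ → Set (c ⊔ ℓ)
HasOrder S n = Inverse S (≡.setoid (Fin n))

record IsField {c ℓ} (R : CommutativeRing c ℓ) : Set (c ⊔ ℓ) where
  open CommutativeRing R
  field
    0≉1      : 0# ≉ 1#
    inverse  : ∀ x → x ≉ 0# → ∃[ y ] x * y ≈ 1#

-- A field with q elements.  GF(q) is unique only up to isomorphism, so
-- statements about it quantify over all such fields.
record GF (c ℓ : Level) (q : ℕ) : Set (lsuc (c ⊔ ℓ)) where
  field
    commutativeRing : CommutativeRing c ℓ
    isField         : IsField commutativeRing
    hasOrder        : HasOrder (CommutativeRing.setoid commutativeRing) q

  open CommutativeRing commutativeRing public
  open IsField isField public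
  open Exp commutativeSemiring public using (_^_)

-- The trace from GF(2ᵐ) to its prime field.
Tr : ∀ {c ℓ} {m : ℕ} (L : GF c ℓ (2 ℕ.^ m)) → GF.Carrier L → GF.Carrier L
Tr {m = m} L μ = sum {m} (λ i → μ ^ (2 ℕ.^ toℕ i))
  where
  open GF L
  open Sum +-commutativeMonoid using (sum)

record Setting (c₁ ℓ₁ c₂ ℓ₂ : Level) (m : ℕ) : Set (lsuc (c₁ ⊔ ℓ₁ ⊔ c₂ ⊔ ℓ₂)) where
  field
    L : GF c₁ ℓ₁ (2 ℕ.^ m)
    F : GF c₂ ℓ₂ (2 ℕ.^ (2 ℕ.* m))

  module L = GF L
  module F = GF F

  field
    ι      : L.Carrier → F.Carrier
    ι-mono : IsRingMonomorphism L.rawRing F.rawRing ι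
    μ      : L.Carrier
    Trμ≈1  : Tr {m = m} L μ L.≈ L.1#
    z      : F.Carrier
    z²+z≈μ : z F.^ 2 F.+ z F.≈ ι μ

  open IsRingMonomorphism ι-mono public

  ⟪_,_⟫ : L.Carrier → L.Carrier → F.Carrier
  ⟪ a , b ⟫ = ι a F.+ ι b F.* z

injective⇒hits : ∀ {n} (f : Fin n → Fin n) → Injective _≡_ _≡_ f → ∀ y → ∃[ x ] f x ≡ y
injective⇒hits {suc n} f inj y with any? (λ x → f x ≟ᶠ y)
... | yes hit = hit
... | no miss = ⊥-elim (ℕₚ.1+n≰n (injective⇒≤ {f = g} g-inj))
  where
  y≢f : ∀ x → y ≢ f x
  y≢f x y≡fx = miss (x , ≡.sym y≡fx)
  g : Fin (suc n) → Fin n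
  g x = punchOut (y≢f x)
  g-inj : Injective _≡_ _≡_ g
  g-inj {x} {x′} eq = inj (punchOut-injective (y≢f x) (y≢f x′) eq)

injective⇒hits² : ∀ {q n} → n ≡ q ℕ.* q → (f : Fin q × Fin q → Fin n) →
                  Injective _≡_ _≡_ f → ∀ y → ∃[ ij ] f ij ≡ y
injective⇒hits² {q} ≡.refl f inj y with injective⇒hits (f ∘ remQuot q) f∘remQuot-inj y
  where
  f∘remQuot-inj : Injective _≡_ _≡_ (f ∘ remQuot q)
  f∘remQuot-inj {i} {j} eq = ≡.trans (≡.sym (combine-remQuot {q} q i))
    (≡.trans (≡.cong (λ (k , l) → combine k l) (inj eq)) (combine-remQuot {q} q j))
... | i , eq = remQuot q i , eq

2^[2*m] : ∀ m → 2 ℕ.^ (2 ℕ.* m) ≡ 2 ℕ.^ m ℕ.* 2 ℕ.^ m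
2^[2*m] m = ≡.trans (≡.cong (λ k → 2 ℕ.^ (m ℕ.+ k)) (ℕₚ.+-identityʳ m)) (ℕₚ.^-distribˡ-+-* 2 m m)

module Single {c ℓ} (M : CommutativeMonoid c ℓ) where
  open CommutativeMonoid M
  open Sum M using (sum; sum-remove; sum-cong-≋; sum-replicate-zero)
  open SetoidReasoning setoid

  sum-single : ∀ {n} (t : Fin n → Carrier) i → (∀ j → j ≢ i → t j ≈ ε) → sum t ≈ t i
  sum-single {suc n} t i others = begin
    sum t                             ≈⟨ sum-remove {i = i} t ⟩
    t i ∙ sum (λ j → t (punchIn i j)) ≈⟨ ∙-congˡ (sum-cong-≋ (λ j → others (punchIn i j) (punchInᵢ≢i i j))) ⟩
    t i ∙ sum {n} (λ _ → ε)           ≈⟨ ∙-congˡ (sum-replicate-zero n) ⟩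
    t i ∙ ε                           ≈⟨ identityʳ (t i) ⟩
    t i                               ∎

module FiniteField {c ℓ} {q : ℕ} (K : GF c ℓ q) where
  open GF K hiding (_^_)
  open Inverse hasOrder using (to; from; to-cong; strictlyInverseˡ; strictlyInverseʳ)
  open Exp commutativeSemiring
  open Mult semiring using (×1-homo-*) renaming (_×_ to _·_)
  open SetoidReasoning setoid
  module Σ+ = Sum +-commutativeMonoid
  module Π* = Sum *-commutativeMonoid
  open AbelianGroupProperties +-abelianGroup using () renaming (∙-cancelʳ to +-cancelʳ)
  open CommutativeSemigroupProperties (CommutativeMonoid.commutativeSemigroup +-commutativeMonoid) public using (interchange)

  infix 4 _≟_
  _≟_ : ∀ x y → Dec (x ≈ y)
  x ≟ y = map′ to-inj to-cong (to x ≟ᶠ to y)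
    where
    to-inj : to x ≡ to y → x ≈ y
    to-inj eq = begin
      x           ≈⟨ strictlyInverseʳ x ⟨
      from (to x) ≡⟨ ≡.cong from eq ⟩
      from (to y) ≈⟨ strictlyInverseʳ y ⟩
      y           ∎

  *-cancel : ∀ x {y w} → x ≉ 0# → x * y ≈ x * w → y ≈ w
  *-cancel x {y} {w} x≉0 eq with inverse x x≉0
  ... | x⁻¹ , xx⁻¹≈1 = begin
    y               ≈⟨ lemma y ⟨
    x⁻¹ * (x * y)   ≈⟨ *-congˡ eq ⟩
    x⁻¹ * (x * w)   ≈⟨ lemma w ⟩
    w               ∎
    where
    lemma : ∀ v → x⁻¹ * (x * v) ≈ v
    lemma v = begin
      x⁻¹ * (x * v)  ≈⟨ *-assoc x⁻¹ x v ⟨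
      x⁻¹ * x * v    ≈⟨ *-congʳ (trans (*-comm x⁻¹ x) xx⁻¹≈1) ⟩
      1# * v         ≈⟨ *-identityˡ v ⟩
      v              ∎

  zero-product : ∀ x y → x * y ≈ 0# → x ≈ 0# ⊎ y ≈ 0#
  zero-product x y xy≈0 with x ≟ 0#
  ... | yes x≈0 = inj₁ x≈0
  ... | no  x≉0 = inj₂ (*-cancel x x≉0 (trans xy≈0 (sym (zeroʳ x))))

  module _ {c′ ℓ′} (M : CommutativeMonoid c′ ℓ′) where
    private module M = CommutativeMonoid M
    open Sum M using (sum; sum-permute; sum-cong-≋)

    reindex : (f : Carrier → M.Carrier) → (∀ {x y} → x ≈ y → f x M.≈ f y) →
              (φ ψ : Carrier → Carrier) →
              (∀ {x y} → x ≈ y → φ x ≈ φ y) → (∀ {x y} → x ≈ y → ψ x ≈ ψ y) →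
              (∀ x → φ (ψ x) ≈ x) → (∀ x → ψ (φ x) ≈ x) →
              sum (λ i → f (φ (from i))) M.≈ sum (λ i → f (from i))
    reindex f f-cong φ ψ φ-cong ψ-cong φψ ψφ = M.sym (M.trans
      (sum-permute (f ∘ from) π)
      (sum-cong-≋ (λ i → f-cong (strictlyInverseʳ (φ (from i))))))
      where
      roundTrip : (α β : Carrier → Carrier) → (∀ {x y} → x ≈ y → α x ≈ α y) →
                  (∀ x → α (β x) ≈ x) → ∀ i → to (α (from (to (β (from i))))) ≡ i
      roundTrip α β α-cong αβ i = ≡.trans
        (to-cong (trans (α-cong (strictlyInverseʳ (β (from i)))) (αβ (from i))))
        (strictlyInverseˡ i)
      π : Permutation q q
      π = permutation (λ i → to (φ (from i))) (λ i → to (ψ (from i)))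
            (roundTrip φ ψ φ-cong φψ) (roundTrip ψ φ ψ-cong ψφ)

  q·1≈0 : q · 1# ≈ 0#
  q·1≈0 = +-cancelʳ total _ _ (begin
    q · 1# + total                  ≈⟨ +-congʳ (Σ+.sum-replicate q) ⟨
    Σ+.sum {q} (λ _ → 1#) + total   ≈⟨ Σ+.∑-distrib-+ {q} (λ _ → 1#) from ⟨
    Σ+.sum (λ i → 1# + from i)      ≈⟨ reindex +-commutativeMonoid (λ x → x) (λ eq → eq)
                                         (1# +_) (- 1# +_) +-congˡ +-congˡ shift shift′ ⟩
    total                           ≈⟨ +-identityˡ total ⟨
    0# + total                      ∎)
    where
    total = Σ+.sum from
    shift : ∀ x → 1# + (- 1# + x) ≈ x
    shift x = trans (sym (+-assoc 1# (- 1#) x)) (trans (+-congʳ (-‿inverseʳ 1#)) (+-identityˡ x))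
    shift′ : ∀ x → - 1# + (1# + x) ≈ x
    shift′ x = trans (sym (+-assoc (- 1#) 1# x)) (trans (+-congʳ (-‿inverseˡ 1#)) (+-identityˡ x))

  1+1≈0 : ∀ m → q ≡ 2 ℕ.^ m → 1# + 1# ≈ 0#
  1+1≈0 m q≡2^m = trans (sym (+-congˡ (+-identityʳ 1#)))
                        (go m (≡.subst (λ k → k · 1# ≈ 0#) q≡2^m q·1≈0))
    where
    go : ∀ k → (2 ℕ.^ k) · 1# ≈ 0# → 2 · 1# ≈ 0#
    go zero    eq = ⊥-elim (0≉1 (trans (sym eq) (+-identityʳ 1#)))
    go (suc k) eq with zero-product (2 · 1#) ((2 ℕ.^ k) · 1#)
                                    (trans (sym (×1-homo-* 2 (2 ℕ.^ k))) eq)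
    ... | inj₁ 2≈0 = 2≈0
    ... | inj₂ eq′ = go k eq′

  product-nonzero : ∀ {n} (t : Fin n → Carrier) → (∀ i → t i ≉ 0#) → Π*.sum t ≉ 0#
  product-nonzero {zero}  t nz eq = 0≉1 (sym eq)
  product-nonzero {suc n} t nz eq with zero-product (t fzero) _ eq
  ... | inj₁ eq₀ = nz fzero eq₀
  ... | inj₂ eqₛ = product-nonzero (t ∘ fsuc) (nz ∘ fsuc) eqₛ

  fill₁ : Carrier → Carrier
  fill₁ x with x ≟ 0#
  ... | yes _ = 1#
  ... | no  _ = x

  mark : Carrier → Carrier → Carrier
  mark v x with x ≟ 0#
  ... | yes _ = v
  ... | no  _ = 1#

  fill₁-cong : ∀ {x y} → x ≈ y → fill₁ x ≈ fill₁ y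
  fill₁-cong {x} {y} x≈y with x ≟ 0# | y ≟ 0#
  ... | yes _   | yes _   = refl
  ... | yes x≈0 | no y≉0  = ⊥-elim (y≉0 (trans (sym x≈y) x≈0))
  ... | no x≉0  | yes y≈0 = ⊥-elim (x≉0 (trans x≈y y≈0))
  ... | no _    | no _    = x≈y

  fill₁-nonzero : ∀ x → fill₁ x ≉ 0#
  fill₁-nonzero x with x ≟ 0#
  ... | yes _   = λ 1≈0 → 0≉1 (sym 1≈0)
  ... | no  x≉0 = x≉0

  mark-zero : ∀ v {x} → x ≈ 0# → mark v x ≈ v
  mark-zero v {x} x≈0 with x ≟ 0#
  ... | yes _   = refl
  ... | no  x≉0 = ⊥-elim (x≉0 x≈0)

  mark-nonzero : ∀ v {x} → x ≉ 0# → mark v x ≈ 1#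
  mark-nonzero v {x} x≉0 with x ≟ 0#
  ... | yes x≈0 = ⊥-elim (x≉0 x≈0)
  ... | no  _   = refl

  scale-fill₁ : ∀ a → a ≉ 0# → ∀ x → a * fill₁ x ≈ mark a x * fill₁ (a * x)
  scale-fill₁ a a≉0 x with x ≟ 0# | a * x ≟ 0#
  ... | yes _   | yes _    = refl
  ... | yes x≈0 | no ax≉0  = ⊥-elim (ax≉0 (trans (*-congˡ x≈0) (zeroʳ a)))
  ... | no x≉0  | yes ax≈0 = ⊥-elim (x≉0 (*-cancel a a≉0 (trans ax≈0 (sym (zeroʳ a)))))
  ... | no _    | no _     = sym (*-identityˡ (a * x))

  fermat-unit : ∀ a → a ≉ 0# → a ^ q ≈ a
  fermat-unit a a≉0 with inverse a a≉0
  ... | a⁻¹ , aa⁻¹≈1 = *-cancel P (product-nonzero _ (fill₁-nonzero ∘ from)) (begin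
    P * a ^ q                                                        ≈⟨ *-comm P (a ^ q) ⟩
    a ^ q * P                                                        ≈⟨ *-congʳ (Π*.sum-replicate q) ⟨
    Π*.sum {q} (λ _ → a) * P                                         ≈⟨ Π*.∑-distrib-+ {q} (λ _ → a) (fill₁ ∘ from) ⟨
    Π*.sum (λ i → a * fill₁ (from i))                                ≈⟨ Π*.sum-cong-≋ (scale-fill₁ a a≉0 ∘ from) ⟩
    Π*.sum (λ i → mark a (from i) * fill₁ (a * from i))              ≈⟨ Π*.∑-distrib-+ (mark a ∘ from) (λ i → fill₁ (a * from i)) ⟩
    Π*.sum (mark a ∘ from) * Π*.sum (λ i → fill₁ (a * from i))       ≈⟨ *-cong marks reindexed ⟩
    a * P                                                            ≈⟨ *-comm a P ⟩
    P * a                                                            ∎)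
    where
    P = Π*.sum (fill₁ ∘ from)
    unit : ∀ x y → x * y ≈ 1# → ∀ v → x * (y * v) ≈ v
    unit x y xy≈1 v = trans (sym (*-assoc x y v)) (trans (*-congʳ xy≈1) (*-identityˡ v))
    reindexed : Π*.sum (λ i → fill₁ (a * from i)) ≈ P
    reindexed = reindex *-commutativeMonoid fill₁ fill₁-cong (a *_) (a⁻¹ *_) *-congˡ *-congˡ
                  (unit a a⁻¹ aa⁻¹≈1) (unit a⁻¹ a (trans (*-comm a⁻¹ a) aa⁻¹≈1))
    from≉0 : ∀ j → j ≢ to 0# → from j ≉ 0#
    from≉0 j j≢ eq = j≢ (≡.trans (≡.sym (strictlyInverseˡ j)) (to-cong eq))
    marks : Π*.sum (mark a ∘ from) ≈ a
    marks = trans (Single.sum-single *-commutativeMonoid (mark a ∘ from) (to 0#)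
                     (λ j j≢ → mark-nonzero a (from≉0 j j≢)))
                  (mark-zero a (strictlyInverseʳ 0#))

  fermat : ∀ a → a ^ q ≈ a
  fermat a with a ≟ 0#
  ... | no  a≉0 = fermat-unit a a≉0
  ... | yes a≈0 = power q (to 0#)
    where
    power : ∀ n → Fin n → a ^ n ≈ a
    power (suc n) _ = trans (*-congʳ a≈0) (trans (zeroˡ _) (sym a≈0))

  module Characteristic2 (char2 : 1# + 1# ≈ 0#) where

    x+x≈0 : ∀ x → x + x ≈ 0#
    x+x≈0 x = begin
      x + x            ≈⟨ +-cong (*-identityˡ x) (*-identityˡ x) ⟨
      1# * x + 1# * x  ≈⟨ distribʳ x 1# 1# ⟨
      (1# + 1#) * x    ≈⟨ *-congʳ char2 ⟩
      0# * x           ≈⟨ zeroˡ x ⟩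
      0#               ∎

    x+y≈0⇒x≈y : ∀ {x y} → x + y ≈ 0# → x ≈ y
    x+y≈0⇒x≈y {x} {y} eq = +-cancelʳ y x y (trans eq (sym (x+x≈0 y)))

    square-+ : ∀ x y → (x + y) ^ 2 ≈ x ^ 2 + y ^ 2
    square-+ x y = begin
      (x + y) * ((x + y) * 1#)              ≈⟨ *-congˡ (*-identityʳ (x + y)) ⟩
      (x + y) * (x + y)                     ≈⟨ distribʳ (x + y) x y ⟩
      x * (x + y) + y * (x + y)             ≈⟨ +-cong (distribˡ x x y) (distribˡ y x y) ⟩
      (x * x + x * y) + (y * x + y * y)     ≈⟨ +-congˡ (+-comm (y * x) (y * y)) ⟩
      (x * x + x * y) + (y * y + y * x)     ≈⟨ interchange (x * x) (x * y) (y * y) (y * x) ⟩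
      (x * x + y * y) + (x * y + y * x)     ≈⟨ +-congˡ (+-congˡ (*-comm y x)) ⟩
      (x * x + y * y) + (x * y + x * y)     ≈⟨ +-congˡ (x+x≈0 (x * y)) ⟩
      (x * x + y * y) + 0#                  ≈⟨ +-identityʳ _ ⟩
      x * x + y * y                         ≈⟨ +-cong (*-congˡ (*-identityʳ x)) (*-congˡ (*-identityʳ y)) ⟨
      x ^ 2 + y ^ 2                         ∎

    frobenius-+ : ∀ i x y → (x + y) ^ (2 ℕ.^ i) ≈ x ^ (2 ℕ.^ i) + y ^ (2 ℕ.^ i)
    frobenius-+ zero    x y = trans (*-identityʳ (x + y)) (sym (+-cong (*-identityʳ x) (*-identityʳ y)))
    frobenius-+ (suc i) x y = begin
      (x + y) ^ (2 ℕ.* n)            ≈⟨ ^-assocʳ (x + y) 2 n ⟨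
      ((x + y) ^ 2) ^ n              ≈⟨ ^-congˡ n (square-+ x y) ⟩
      (x ^ 2 + y ^ 2) ^ n            ≈⟨ frobenius-+ i (x ^ 2) (y ^ 2) ⟩
      (x ^ 2) ^ n + (y ^ 2) ^ n      ≈⟨ +-cong (^-assocʳ x 2 n) (^-assocʳ y 2 n) ⟩
      x ^ (2 ℕ.* n) + y ^ (2 ℕ.* n)  ∎
      where n = 2 ℕ.^ i

    telescope : ∀ n (h : ℕ → Carrier) → Σ+.sum {n} (λ i → h (suc (toℕ i)) + h (toℕ i)) ≈ h n + h 0
    telescope zero    h = sym (x+x≈0 (h 0))
    telescope (suc n) h = begin
      (h 1 + h 0) + Σ+.sum {n} (λ i → h (suc (suc (toℕ i))) + h (suc (toℕ i)))
                                       ≈⟨ +-congˡ (telescope n (h ∘ suc)) ⟩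
      (h 1 + h 0) + (h (suc n) + h 1)  ≈⟨ +-congˡ (+-comm (h (suc n)) (h 1)) ⟩
      (h 1 + h 0) + (h 1 + h (suc n))  ≈⟨ interchange (h 1) (h 0) (h 1) (h (suc n)) ⟩
      (h 1 + h 1) + (h 0 + h (suc n))  ≈⟨ +-congʳ (x+x≈0 (h 1)) ⟩
      0# + (h 0 + h (suc n))           ≈⟨ +-identityˡ _ ⟩
      h 0 + h (suc n)                  ≈⟨ +-comm (h 0) (h (suc n)) ⟩
      h (suc n) + h 0                  ∎

Tr-ArtinSchreier : ∀ {c ℓ} {m : ℕ} (K : GF c ℓ (2 ℕ.^ m)) → let open GF K in
                   ∀ w μ → w ^ 2 + w ≈ μ → Tr {m = m} K μ ≈ 0#
Tr-ArtinSchreier {m = m} K w μ w²+w≈μ = begin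
  Σ+.sum {m} (λ i → μ ^ (2 ℕ.^ toℕ i))              ≈⟨ Σ+.sum-cong-≋ {m} (step ∘ toℕ) ⟩
  Σ+.sum {m} (λ i → h (suc (toℕ i)) + h (toℕ i))    ≈⟨ telescope m h ⟩
  w ^ (2 ℕ.^ m) + w ^ 1                             ≈⟨ +-cong (fermat w) (*-identityʳ w) ⟩
  w + w                                             ≈⟨ x+x≈0 w ⟩
  0#                                                ∎
  where
  open GF K hiding (_^_)
  open Exp commutativeSemiring
  open FiniteField K
  open Characteristic2 (1+1≈0 m ≡.refl)
  open SetoidReasoning setoid
  h : ℕ → Carrier
  h i = w ^ (2 ℕ.^ i)
  step : ∀ i → μ ^ (2 ℕ.^ i) ≈ h (suc i) + h i
  step i = begin
    μ ^ (2 ℕ.^ i)                      ≈⟨ ^-congˡ (2 ℕ.^ i) w²+w≈μ ⟨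
    (w ^ 2 + w) ^ (2 ℕ.^ i)            ≈⟨ frobenius-+ i (w ^ 2) w ⟩
    (w ^ 2) ^ (2 ℕ.^ i) + h i          ≈⟨ +-congʳ (^-assocʳ w 2 (2 ℕ.^ i)) ⟩
    h (suc i) + h i                    ∎

module Basis {c₁ ℓ₁ c₂ ℓ₂ : Level} {m : ℕ} (S : Setting c₁ ℓ₁ c₂ ℓ₂ m) where
  open Setting S
  private
    module Lₚ = FiniteField L
    module Fₚ = FiniteField F
    module L₂ = Lₚ.Characteristic2 (Lₚ.1+1≈0 m ≡.refl)
    module F₂ = Fₚ.Characteristic2 (Fₚ.1+1≈0 (2 ℕ.* m) ≡.refl)

  -- abstract: the pigeonhole search behind ⟪⟫-surjective should never unfold.
  abstract
    z∉L : ∀ w → ι w F.≉ z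
    z∉L w ιw≈z = L.0≉1 (L.trans (L.sym (Tr-ArtinSchreier {m = m} L w μ w²+w≈μ)) Trμ≈1)
      where
      open SetoidReasoning F.setoid
      w²+w≈μ : w L.^ 2 L.+ w L.≈ μ
      w²+w≈μ = injective (begin
        ι (w L.^ 2 L.+ w)                      ≈⟨ +-homo (w L.^ 2) w ⟩
        ι (w L.* (w L.* L.1#)) F.+ ι w         ≈⟨ F.+-congʳ (*-homo w (w L.* L.1#)) ⟩
        ι w F.* ι (w L.* L.1#) F.+ ι w         ≈⟨ F.+-congʳ (F.*-congˡ (*-homo w L.1#)) ⟩
        ι w F.* (ι w F.* ι L.1#) F.+ ι w       ≈⟨ F.+-cong (F.*-cong ιw≈z (F.*-cong ιw≈z 1#-homo)) ιw≈z ⟩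
        z F.^ 2 F.+ z                          ≈⟨ z²+z≈μ ⟩
        ι μ                                    ∎)

    ⟪⟫≈0 : ∀ a b → ⟪ a , b ⟫ F.≈ F.0# → a L.≈ L.0# × b L.≈ L.0#
    ⟪⟫≈0 a b eq = injective (F.trans ιa≈0 (F.sym 0#-homo)) , b≈0
      where
      open SetoidReasoning F.setoid
      ιa≈ιb*z : ι a F.≈ ι b F.* z
      ιa≈ιb*z = F₂.x+y≈0⇒x≈y eq
      b≈0 : b L.≈ L.0#
      b≈0 with b Lₚ.≟ L.0#
      ... | yes b≈0 = b≈0
      ... | no  b≉0 with L.inverse b b≉0
      ...   | b⁻¹ , bb⁻¹≈1 = ⊥-elim (z∉L (b⁻¹ L.* a) (begin
        ι (b⁻¹ L.* a)             ≈⟨ *-homo b⁻¹ a ⟩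
        ι b⁻¹ F.* ι a             ≈⟨ F.*-congˡ ιa≈ιb*z ⟩
        ι b⁻¹ F.* (ι b F.* z)     ≈⟨ F.*-assoc (ι b⁻¹) (ι b) z ⟨
        ι b⁻¹ F.* ι b F.* z       ≈⟨ F.*-congʳ (*-homo b⁻¹ b) ⟨
        ι (b⁻¹ L.* b) F.* z       ≈⟨ F.*-congʳ (⟦⟧-cong (L.trans (L.*-comm b⁻¹ b) bb⁻¹≈1)) ⟩
        ι L.1# F.* z              ≈⟨ F.*-congʳ 1#-homo ⟩
        F.1# F.* z                ≈⟨ F.*-identityˡ z ⟩
        z                         ∎))
      ιa≈0 : ι a F.≈ F.0#
      ιa≈0 = begin
        ι a            ≈⟨ ιa≈ιb*z ⟩
        ι b F.* z      ≈⟨ F.*-congʳ (F.trans (⟦⟧-cong b≈0) 0#-homo) ⟩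
        F.0# F.* z     ≈⟨ F.zeroˡ z ⟩
        F.0#           ∎

    ⟪⟫-injective : ∀ a b c d → ⟪ a , b ⟫ F.≈ ⟪ c , d ⟫ → a L.≈ c × b L.≈ d
    ⟪⟫-injective a b c d eq = L₂.x+y≈0⇒x≈y (proj₁ both) , L₂.x+y≈0⇒x≈y (proj₂ both)
      where
      open SetoidReasoning F.setoid
      both : (a L.+ c) L.≈ L.0# × (b L.+ d) L.≈ L.0#
      both = ⟪⟫≈0 (a L.+ c) (b L.+ d) (begin
        ι (a L.+ c) F.+ ι (b L.+ d) F.* z                ≈⟨ F.+-cong (+-homo a c) (F.*-congʳ (+-homo b d)) ⟩
        (ι a F.+ ι c) F.+ (ι b F.+ ι d) F.* z            ≈⟨ F.+-congˡ (F.distribʳ z (ι b) (ι d)) ⟩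
        (ι a F.+ ι c) F.+ (ι b F.* z F.+ ι d F.* z)      ≈⟨ Fₚ.interchange (ι a) (ι c) (ι b F.* z) (ι d F.* z) ⟩
        ⟪ a , b ⟫ F.+ ⟪ c , d ⟫                          ≈⟨ F.+-congʳ eq ⟩
        ⟪ c , d ⟫ F.+ ⟪ c , d ⟫                          ≈⟨ F₂.x+x≈0 ⟪ c , d ⟫ ⟩
        F.0#                                             ∎)

    ⟪⟫-surjective : ∀ x → Σ[ a ∈ L.Carrier ] Σ[ b ∈ L.Carrier ] ⟪ a , b ⟫ F.≈ x
    ⟪⟫-surjective x = a₀ , b₀ , to-injective ⟪ a₀ , b₀ ⟫ x (proj₂ hit)
      where
      module Fi = Inverse F.hasOrder
      module Li = Inverse L.hasOrder
      point : Fin (2 ℕ.^ m) × Fin (2 ℕ.^ m) → F.Carrier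
      point (i , j) = ⟪ Li.from i , Li.from j ⟫
      from-injective : ∀ i j → Li.from i L.≈ Li.from j → i ≡ j
      from-injective i j eq = ≡.trans (≡.sym (Li.strictlyInverseˡ i))
        (≡.trans (Li.to-cong eq) (Li.strictlyInverseˡ j))
      to-injective : ∀ x y → Fi.to x ≡ Fi.to y → x F.≈ y
      to-injective x y eq = F.trans (F.sym (Fi.strictlyInverseʳ x))
        (F.trans (Fi.from-cong eq) (Fi.strictlyInverseʳ y))
      code-injective : Injective _≡_ _≡_ (Fi.to ∘ point)
      code-injective {i , j} {k , l} eq =
        let a≈c , b≈d = ⟪⟫-injective _ _ _ _ (to-injective (point (i , j)) (point (k , l)) eq) in
        ≡.cong₂ _,_ (from-injective i k a≈c) (from-injective j l b≈d)
      hit : ∃[ ij ] Fi.to (point ij) ≡ Fi.to x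
      hit = injective⇒hits² (2^[2*m] m) (Fi.to ∘ point) code-injective (Fi.to x)
      a₀ b₀ : L.Carrier
      a₀ = Li.from (proj₁ (proj₁ hit))
      b₀ = Li.from (proj₂ (proj₁ hit))

  coordinates : F.Carrier → L.Carrier × L.Carrier
  coordinates x = proj₁ (⟪⟫-surjective x) , proj₁ (proj₂ (⟪⟫-surjective x))

record IsPresemifield {c ℓ} (R : RawRingWithoutOne c ℓ) (n : ℕ) : Set (c ⊔ ℓ) where
  open RawRingWithoutOne R
  open AlgebraDefinitions _≈_
  field
    +-isAbelianGroup : IsAbelianGroup _≈_ _+_ 0# (-_)
    order            : HasOrder (IsAbelianGroup.setoid +-isAbelianGroup) n
    *-cong           : Congruent₂ _*_
    distrib          : _*_ DistributesOver _+_
    noZeroDivisors   : ∀ x y → x * y ≈ 0# → x ≈ 0# ⊎ y ≈ 0#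

record Quadruple {a} (A : Set a) : Set a where
  constructor [_,_,_,_]
  field
    p₁ p₂ p₃ p₄ : A

module _ {c₁ ℓ₁ c₂ ℓ₂ : Level} {m : ℕ} (S : Setting c₁ ℓ₁ c₂ ℓ₂ m) (s : ℕ) where
  open Setting S

  private
    σ : ℕ
    σ = 2 ℕ.^ s

  poly : Quadruple L.Carrier → L.Carrier → L.Carrier
  poly [ p₁ , p₂ , p₃ , p₄ ] X = p₁ * X ^ (σ ℕ.+ 1) + p₂ * X ^ σ + p₃ * X + p₄
    where open L

  -- Roots are sought in L only, not at infinity, so p₁ ≈ 0 is not excluded here.
  Legitimate : Quadruple L.Carrier → Set (c₁ ⊔ ℓ₁)
  Legitimate t = ¬ (∃[ X ] poly t X L.≈ L.0#)

  -- Membership in (L*)^(σ-1); truncated subtraction is exact as σ ≥ 1.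
  IsPower[σ-1] : L.Carrier → Set (c₁ ⊔ ℓ₁)
  IsPower[σ-1] v = ∃[ u ] (u L.≉ L.0# × v L.≈ u L.^ (σ ℕ.∸ 1))

  mul : L.Carrier → Quadruple L.Carrier →
        L.Carrier × L.Carrier → L.Carrier × L.Carrier → L.Carrier × L.Carrier
  mul l [ p₁ , p₂ , p₃ , p₄ ] (a , b) (c , d) =
      p₁ * a * c ^ σ + l * p₁ * a ^ σ * c
    + p₂ * b * c ^ σ + l * p₂ * a ^ σ * d
    + p₃ * a * d ^ σ + l * p₃ * b ^ σ * c
    + p₄ * b * d ^ σ + l * p₄ * b ^ σ * d
    , a * d + b * c
    where open L

  B : L.Carrier → Quadruple L.Carrier → RawRingWithoutOne c₂ ℓ₂
  B l t = record
    { Carrier = F.Carrier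
    ; _≈_     = F._≈_
    ; _+_     = F._+_
    ; _*_     = λ x y → let (e , f) = mul l t (coordinates x) (coordinates y) in ⟪ e , f ⟫
    ; -_      = F.-_
    ; 0#      = F.0#
    }
    where open Basis S

-- If x ∘ y = 0 then the second coordinate makes x and y proportional over L, and for y = k x
-- the first coordinate factors as (k^σ + l k) N(x) with N(a,b) = p₁a^(σ+1) + p₂a^σb + p₃ab^σ + p₄b^(σ+1).
-- For nonzero k the first factor vanishes only if l = k^(σ-1).  For nonzero x so does N(x) only if
-- a/b is a root of p_{s,t}, or b = 0 and p₁ = 0.
module Submission where

open import Defs
open import Level using (Level)
open import Data.Nat.Base as ℕ using (ℕ; zero; suc; _≥_; _<_)
open import Data.Product.Base using (_×_; _,_; proj₁; proj₂; ∃-syntax)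
open import Data.Sum.Base using (_⊎_; inj₁; inj₂)
open import Relation.Nullary using (¬_; yes; no)
open import Algebra.Bundles using (CommutativeSemiring)
import Algebra.Properties.CommutativeSemiring.Exp as Exp
import Algebra.Solver.Ring.NaturalCoefficients.Default as SemiringSolver
open import Data.Empty using (⊥-elim)
import Data.Nat.Properties as ℕₚ
import Relation.Binary.PropositionalEquality as ≡
import Relation.Binary.Reasoning.Setoid as SetoidReasoning

-- Polynomial identities for the first coordinate and for the norm form.

-- Powers a^σ are represented by independent variables A, so that the identities below
-- are polynomial ones.
module BilinearForm {c ℓ} (R : CommutativeSemiring c ℓ) where
  open CommutativeSemiring R
  open SemiringSolver R

  form : (l p₁ p₂ p₃ p₄ a A b B c C d D : Carrier) → Carrier
  form l p₁ p₂ p₃ p₄ a A b B c C d D =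
      p₁ * a * C + l * p₁ * A * c
    + p₂ * b * C + l * p₂ * A * d
    + p₃ * a * D + l * p₃ * B * c
    + p₄ * b * D + l * p₄ * B * d

  -- The homogenisation of p_{s,t} in the ratio a/b, with `A` and `B` standing for a^σ and b^σ.
  norm : (p₁ p₂ p₃ p₄ a A b B : Carrier) → Carrier
  norm p₁ p₂ p₃ p₄ a A b B = p₁ * (A * a) + p₂ * (A * b) + p₃ * (a * B) + p₄ * (B * b)

  private
    form′ : ∀ {n} (l p₁ p₂ p₃ p₄ a A b B c C d D : Polynomial n) → Polynomial n
    form′ l p₁ p₂ p₃ p₄ a A b B c C d D =
        p₁ :* a :* C :+ l :* p₁ :* A :* c
      :+ p₂ :* b :* C :+ l :* p₂ :* A :* d
      :+ p₃ :* a :* D :+ l :* p₃ :* B :* c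
      :+ p₄ :* b :* D :+ l :* p₄ :* B :* d

    norm′ : ∀ {n} (p₁ p₂ p₃ p₄ a A b B : Polynomial n) → Polynomial n
    norm′ p₁ p₂ p₃ p₄ a A b B =
      p₁ :* (A :* a) :+ p₂ :* (A :* b) :+ p₃ :* (a :* B) :+ p₄ :* (B :* b)

  module _ (l p₁ p₂ p₃ p₄ : Carrier) where

    form-cong : ∀ {a a′ A A′ b b′ B B′ c c′ C C′ d d′ D D′} →
      a ≈ a′ → A ≈ A′ → b ≈ b′ → B ≈ B′ → c ≈ c′ → C ≈ C′ → d ≈ d′ → D ≈ D′ →
      form l p₁ p₂ p₃ p₄ a A b B c C d D ≈ form l p₁ p₂ p₃ p₄ a′ A′ b′ B′ c′ C′ d′ D′
    form-cong a A b B c C d D =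
      +-cong (+-cong (+-cong (+-cong (+-cong (+-cong (+-cong
        (*-cong (*-congˡ a) C) (*-cong (*-congˡ A) c))
        (*-cong (*-congˡ b) C)) (*-cong (*-congˡ A) d))
        (*-cong (*-congˡ a) D)) (*-cong (*-congˡ B) c))
        (*-cong (*-congˡ b) D)) (*-cong (*-congˡ B) d)

    -- Every monomial of `form` contains exactly one of `c`, `C`, `d`, `D` and exactly one of `a`,
    -- `A`, `b`, `B`. This and `form-distribʳ` therefore hold over any commutative semiring.
    form-distribˡ : ∀ a A b B c C d D c′ C′ d′ D′ →
      form l p₁ p₂ p₃ p₄ a A b B (c + c′) (C + C′) (d + d′) (D + D′) ≈
      form l p₁ p₂ p₃ p₄ a A b B c C d D + form l p₁ p₂ p₃ p₄ a A b B c′ C′ d′ D′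
    form-distribˡ = solve 17 (λ l p₁ p₂ p₃ p₄ a A b B c C d D c′ C′ d′ D′ →
      form′ l p₁ p₂ p₃ p₄ a A b B (c :+ c′) (C :+ C′) (d :+ d′) (D :+ D′) :=
      form′ l p₁ p₂ p₃ p₄ a A b B c C d D :+ form′ l p₁ p₂ p₃ p₄ a A b B c′ C′ d′ D′)
      refl l p₁ p₂ p₃ p₄

    form-distribʳ : ∀ c C d D a A b B a′ A′ b′ B′ →
      form l p₁ p₂ p₃ p₄ (a + a′) (A + A′) (b + b′) (B + B′) c C d D ≈
      form l p₁ p₂ p₃ p₄ a A b B c C d D + form l p₁ p₂ p₃ p₄ a′ A′ b′ B′ c C d D
    form-distribʳ = solve 17 (λ l p₁ p₂ p₃ p₄ c C d D a A b B a′ A′ b′ B′ →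
      form′ l p₁ p₂ p₃ p₄ (a :+ a′) (A :+ A′) (b :+ b′) (B :+ B′) c C d D :=
      form′ l p₁ p₂ p₃ p₄ a A b B c C d D :+ form′ l p₁ p₂ p₃ p₄ a′ A′ b′ B′ c C d D)
      refl l p₁ p₂ p₃ p₄

    -- The eight terms pair up by their coefficient pᵢ: the term without `l` contributes `K`, its
    -- partner contributes `l * k`, and both leave the same monomial of `norm`.
    form-proportional : ∀ k K a A b B →
      form l p₁ p₂ p₃ p₄ a A b B (k * a) (K * A) (k * b) (K * B) ≈
      (K + l * k) * norm p₁ p₂ p₃ p₄ a A b B
    form-proportional = solve 11 (λ l p₁ p₂ p₃ p₄ k K a A b B →
      form′ l p₁ p₂ p₃ p₄ a A b B (k :* a) (K :* A) (k :* b) (K :* B) :=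
      (K :+ l :* k) :* norm′ p₁ p₂ p₃ p₄ a A b B)
      refl l p₁ p₂ p₃ p₄

  module _ (p₁ p₂ p₃ p₄ : Carrier) where

    norm-cong : ∀ {a a′ A A′} b B → a ≈ a′ → A ≈ A′ →
      norm p₁ p₂ p₃ p₄ a A b B ≈ norm p₁ p₂ p₃ p₄ a′ A′ b B
    norm-cong b B a A =
      +-congʳ (+-cong (+-cong (*-congˡ (*-cong A a)) (*-congˡ (*-congʳ A))) (*-congˡ (*-congʳ a)))

    -- Dehomogenisation at a = xb: each monomial yields one factor `b` and one factor `B`.
    norm-homogeneous : ∀ x X b B →
      norm p₁ p₂ p₃ p₄ (x * b) (X * B) b B ≈
      (B * b) * (p₁ * (X * x) + p₂ * X + p₃ * x + p₄)
    norm-homogeneous = solve 8 (λ p₁ p₂ p₃ p₄ x X b B →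
      norm′ p₁ p₂ p₃ p₄ (x :* b) (X :* B) b B :=
      (B :* b) :* (p₁ :* (X :* x) :+ p₂ :* X :+ p₃ :* x :+ p₄))
      refl p₁ p₂ p₃ p₄

module Multiplication {c₁ ℓ₁ c₂ ℓ₂ : Level} {m : ℕ} (S : Setting c₁ ℓ₁ c₂ ℓ₂ m) (s : ℕ)
                      (t : Quadruple (GF.Carrier (Setting.L S)))
                      (l : GF.Carrier (Setting.L S)) where
  open Setting S
  open L
  open Quadruple t
  open Basis S using (⟪⟫-injective; ⟪⟫-surjective; coordinates)
  open FiniteField L using (_≟_; *-cancel; zero-product; interchange)
  open FiniteField.Characteristic2 L (FiniteField.1+1≈0 L m ≡.refl)
  open Exp commutativeSemiring using (^-congˡ; ^-homo-*; ^-distrib-*)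
  open BilinearForm commutativeSemiring
  open SetoidReasoning setoid

  private
    σ : ℕ
    σ = 2 ℕ.^ s

  -- Biadditivity of the product on coordinate pairs over `L`.

  Pair : Set c₁
  Pair = Carrier × Carrier

  infix 4 _≋_
  _≋_ : Pair → Pair → Set ℓ₁
  (a , b) ≋ (c , d) = (a ≈ c) × (b ≈ d)

  infixl 6 _⊞_
  _⊞_ : Pair → Pair → Pair
  (a , b) ⊞ (c , d) = (a + c) , (b + d)

  infixl 7 _⊙_
  _⊙_ : Pair → Pair → Pair
  _⊙_ = mul S s l t

  ⊙-cong : ∀ {x x′ y y′} → x ≋ x′ → y ≋ y′ → x ⊙ y ≋ x′ ⊙ y′
  ⊙-cong (a , b) (c , d) =
      form-cong l p₁ p₂ p₃ p₄ a (^-congˡ σ a) b (^-congˡ σ b) c (^-congˡ σ c) d (^-congˡ σ d)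
    , +-cong (*-cong a d) (*-cong b c)

  -- Characteristic 2 enters through `frobenius-+`: since σ is a power of 2, raising to the σ is
  -- additive, which matches the independent variables `C + C′` and `D + D′` of `form-distribˡ`.
  ⊙-distribˡ-⊞ : ∀ x y w → x ⊙ (y ⊞ w) ≋ x ⊙ y ⊞ x ⊙ w
  ⊙-distribˡ-⊞ (a , b) (c , d) (c′ , d′) =
      trans (form-cong l p₁ p₂ p₃ p₄ refl refl refl refl
              refl (frobenius-+ s c c′) refl (frobenius-+ s d d′))
            (form-distribˡ l p₁ p₂ p₃ p₄ a (a ^ σ) b (b ^ σ) c (c ^ σ) d (d ^ σ)
              c′ (c′ ^ σ) d′ (d′ ^ σ))
    , trans (+-cong (distribˡ a d d′) (distribˡ b c c′)) (interchange _ _ _ _)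

  ⊙-distribʳ-⊞ : ∀ y x w → (x ⊞ w) ⊙ y ≋ x ⊙ y ⊞ w ⊙ y
  ⊙-distribʳ-⊞ (c , d) (a , b) (a′ , b′) =
      trans (form-cong l p₁ p₂ p₃ p₄ refl (frobenius-+ s a a′) refl (frobenius-+ s b b′)
              refl refl refl refl)
            (form-distribʳ l p₁ p₂ p₃ p₄ c (c ^ σ) d (d ^ σ) a (a ^ σ) b (b ^ σ)
              a′ (a′ ^ σ) b′ (b′ ^ σ))
    , trans (+-cong (distribʳ d a a′) (distribʳ c b b′)) (interchange _ _ _ _)

  -- Absence of zero divisors on coordinate pairs.

  *-nonzero : ∀ {x y} → x ≉ 0# → y ≉ 0# → x * y ≉ 0#
  *-nonzero {x} {y} x≉0 y≉0 xy≈0 with zero-product x y xy≈0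
  ... | inj₁ x≈0 = x≉0 x≈0
  ... | inj₂ y≈0 = y≉0 y≈0

  ^-nonzero : ∀ n {x} → x ≉ 0# → x ^ n ≉ 0#
  ^-nonzero zero    x≉0 1≈0 = 0≉1 (sym 1≈0)
  ^-nonzero (suc n) x≉0     = *-nonzero x≉0 (^-nonzero n x≉0)

  0^σ≈0 : 0# ^ σ ≈ 0#
  -- The positivity proof rules out σ = 0, where the power would be 1.
  0^σ≈0 with σ | ℕₚ.m^n>0 2 s
  ... | suc n | _ = zeroˡ (0# ^ n)

  x^σ≈x^[σ∸1]*x : ∀ x → x ^ σ ≈ x ^ (σ ℕ.∸ 1) * x
  x^σ≈x^[σ∸1]*x x with σ | ℕₚ.m^n>0 2 s
  ... | suc n | _ = *-comm x (x ^ n)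

  scale : Carrier → Pair → Pair
  scale k (a , b) = (k * a) , (k * b)

  σ-norm : Pair → Carrier
  σ-norm (a , b) = norm p₁ p₂ p₃ p₄ a (a ^ σ) b (b ^ σ)

  quotient : ∀ y x → x ≉ 0# → ∃[ q ] q * x ≈ y
  quotient y x x≉0 = let x⁻¹ , xx⁻¹≈1 = inverse x x≉0 in y * x⁻¹ , (begin
    y * x⁻¹ * x    ≈⟨ *-assoc y x⁻¹ x ⟩
    y * (x⁻¹ * x)  ≈⟨ *-congˡ (trans (*-comm x⁻¹ x) xx⁻¹≈1) ⟩
    y * 1#         ≈⟨ *-identityʳ y ⟩
    y              ∎)

  -- In characteristic 2 the second coordinate ad + bc is the determinant of the two pairs. The
  -- ratio `k` is c/a if a is nonzero, and d/b otherwise.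
  proportional : ∀ x y → ¬ x ≋ (0# , 0#) → proj₂ (x ⊙ y) ≈ 0# → ∃[ k ] y ≋ scale k x
  proportional (a , b) (c , d) x≉0 eq with a ≟ 0# | b ≟ 0#
  ... | yes a≈0 | yes b≈0 = ⊥-elim (x≉0 (a≈0 , b≈0))
  ... | no a≉0  | _ =
    let k , ka≈c = quotient c a a≉0 in
    k , sym ka≈c , *-cancel a a≉0 (begin
      a * d        ≈⟨ x+y≈0⇒x≈y eq ⟩
      b * c        ≈⟨ *-congˡ ka≈c ⟨
      b * (k * a)  ≈⟨ *-comm b (k * a) ⟩
      k * a * b    ≈⟨ *-congʳ (*-comm k a) ⟩
      a * k * b    ≈⟨ *-assoc a k b ⟩
      a * (k * b)  ∎)
  ... | yes a≈0 | no b≉0 =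
    let k , kb≈d = quotient d b b≉0 in
    -- With a = 0 the determinant condition gives bc = 0, and b(ka) is zero as well.
    k , *-cancel b b≉0 (begin
      b * c        ≈⟨ x+y≈0⇒x≈y eq ⟨
      a * d        ≈⟨ *-congʳ a≈0 ⟩
      0# * d       ≈⟨ zeroˡ d ⟩
      0#           ≈⟨ zeroʳ (b * k) ⟨
      b * k * 0#   ≈⟨ *-congˡ a≈0 ⟨
      b * k * a    ≈⟨ *-assoc b k a ⟩
      b * (k * a)  ∎)
    , sym kb≈d

  -- Multiplicativity of the σ-power allows `K` to be taken as `k ^ σ` in `form-proportional`.
  scale-⊙ : ∀ k x → proj₁ (x ⊙ scale k x) ≈ (k ^ σ + l * k) * σ-norm x
  scale-⊙ k (a , b) = trans
    (form-cong l p₁ p₂ p₃ p₄ refl refl refl refl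
      refl (^-distrib-* k a σ) refl (^-distrib-* k b σ))
    (form-proportional l p₁ p₂ p₃ p₄ k (k ^ σ) a (a ^ σ) b (b ^ σ))

  -- If l = 0 the sum is just k^σ. Otherwise a zero means k^σ = lk, and cancelling one `k` exhibits
  -- `l` as a forbidden power.
  k^σ+lk≉0 : (l ≈ 0#) ⊎ ((l ≉ 0#) × ¬ IsPower[σ-1] S s l) → ∀ k → k ≉ 0# → k ^ σ + l * k ≉ 0#
  k^σ+lk≉0 (inj₁ l≈0) k k≉0 eq =
    ^-nonzero σ k≉0 (trans (x+y≈0⇒x≈y eq) (trans (*-congʳ l≈0) (zeroˡ k)))
  k^σ+lk≉0 (inj₂ (_ , notPower)) k k≉0 eq = notPower (k , k≉0 , *-cancel k k≉0 (begin
    k * l                ≈⟨ *-comm k l ⟩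
    l * k                ≈⟨ x+y≈0⇒x≈y eq ⟨
    k ^ σ                ≈⟨ x^σ≈x^[σ∸1]*x k ⟩
    k ^ (σ ℕ.∸ 1) * k    ≈⟨ *-comm _ k ⟩
    k * k ^ (σ ℕ.∸ 1)    ∎))

  σ-norm≈poly : ∀ x b → σ-norm (x * b , b) ≈ (b ^ σ * b) * poly S s t x
  σ-norm≈poly x b = begin
    σ-norm (x * b , b)
      ≈⟨ norm-cong p₁ p₂ p₃ p₄ b (b ^ σ) refl (^-distrib-* x b σ) ⟩
    norm p₁ p₂ p₃ p₄ (x * b) (x ^ σ * b ^ σ) b (b ^ σ)
      ≈⟨ norm-homogeneous p₁ p₂ p₃ p₄ x (x ^ σ) b (b ^ σ) ⟩
    (b ^ σ * b) * (p₁ * (x ^ σ * x) + p₂ * x ^ σ + p₃ * x + p₄)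
      ≈⟨ *-congˡ (+-congʳ (+-congʳ (+-congʳ (*-congˡ x^[σ+1])))) ⟨
    (b ^ σ * b) * poly S s t x
      ∎
    where
    x^[σ+1] : x ^ (σ ℕ.+ 1) ≈ x ^ σ * x
    x^[σ+1] = trans (^-homo-* x σ 1) (*-congˡ (*-identityʳ x))

  -- The value at the point at infinity of the projective line, where only the leading coefficient
  -- survives.
  σ-norm-at-b≈0 : ∀ a {b} → b ≈ 0# → σ-norm (a , b) ≈ p₁ * (a ^ σ * a)
  σ-norm-at-b≈0 a {b} b≈0 = begin
    p₁ * (a ^ σ * a) + p₂ * (a ^ σ * b) + p₃ * (a * b ^ σ) + p₄ * (b ^ σ * b)
      ≈⟨ +-cong (+-cong (+-congˡ (vanish p₂ (a ^ σ) b≈0)) (vanish p₃ a b^σ≈0))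
                (vanish p₄ (b ^ σ) b≈0) ⟩
    p₁ * (a ^ σ * a) + 0# + 0# + 0#
      ≈⟨ trans (+-identityʳ _) (trans (+-identityʳ _) (+-identityʳ _)) ⟩
    p₁ * (a ^ σ * a)
      ∎
    where
    b^σ≈0 : b ^ σ ≈ 0#
    b^σ≈0 = trans (^-congˡ σ b≈0) 0^σ≈0
    vanish : ∀ p u {v} → v ≈ 0# → p * (u * v) ≈ 0#
    vanish p u v≈0 = trans (*-congˡ (trans (*-congˡ v≈0) (zeroʳ u))) (zeroʳ p)

  module _ (legitimate : Legitimate S s t) (p₁≉0 : p₁ ≉ 0#) where

    -- The norm form has no zero on the projective line over `L`: `p₁≉0` handles the point at
    -- infinity, and legitimacy handles the affine points.
    σ-norm-nonzero : ∀ x → ¬ x ≋ (0# , 0#) → σ-norm x ≉ 0#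
    σ-norm-nonzero (a , b) x≉0 eq with b ≟ 0#
    ... | yes b≈0 =
      *-nonzero p₁≉0 (*-nonzero (^-nonzero σ a≉0) a≉0) (trans (sym (σ-norm-at-b≈0 a b≈0)) eq)
      where
      a≉0 : a ≉ 0#
      a≉0 a≈0 = x≉0 (a≈0 , b≈0)
    ... | no b≉0 =
      -- `r` is the affine coordinate a/b, which a zero of the norm form would make a root of
      -- p_{s,t}.
      let r , rb≈a = quotient a b b≉0 in
      *-nonzero (*-nonzero (^-nonzero σ b≉0) b≉0) (λ root → legitimate (r , root)) (begin
        (b ^ σ * b) * poly S s t r  ≈⟨ σ-norm≈poly r b ⟨
        σ-norm (r * b , b)          ≈⟨ norm-cong p₁ p₂ p₃ p₄ b (b ^ σ) rb≈a (^-congˡ σ rb≈a) ⟩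
        σ-norm (a , b)              ≈⟨ eq ⟩
        0#                          ∎)

    ⊙-nonzero : (l ≈ 0#) ⊎ ((l ≉ 0#) × ¬ IsPower[σ-1] S s l) →
                ∀ x y → ¬ x ≋ (0# , 0#) → ¬ y ≋ (0# , 0#) → ¬ x ⊙ y ≋ (0# , 0#)
    ⊙-nonzero l-cond x y x≉0 y≉0 (eq₁ , eq₂) =
      let k , y≋kx = proportional x y x≉0 eq₂
          -- A zero ratio would make `y` the zero pair.
          k≉0 = λ k≈0 → y≉0 ( trans (proj₁ y≋kx) (trans (*-congʳ k≈0) (zeroˡ _))
                            , trans (proj₂ y≋kx) (trans (*-congʳ k≈0) (zeroˡ _)))
      in *-nonzero (k^σ+lk≉0 l-cond k k≉0) (σ-norm-nonzero x x≉0) (begin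
        (k ^ σ + l * k) * σ-norm x  ≈⟨ scale-⊙ k x ⟨
        proj₁ (x ⊙ scale k x)       ≈⟨ proj₁ (⊙-cong {x} {x} (refl , refl) y≋kx) ⟨
        proj₁ (x ⊙ y)               ≈⟨ eq₁ ⟩
        0#                          ∎)

  -- Passage between coordinate pairs and elements of `F`.

  fromPair : Pair → F.Carrier
  fromPair (a , b) = ⟪ a , b ⟫

  fromPair-cong : ∀ {x y} → x ≋ y → fromPair x F.≈ fromPair y
  fromPair-cong (a , b) = F.+-cong (⟦⟧-cong a) (F.*-congʳ (⟦⟧-cong b))

  fromPair-⊞ : ∀ x y → fromPair (x ⊞ y) F.≈ fromPair x F.+ fromPair y
  fromPair-⊞ (a , b) (c , d) = F.trans
    (F.+-cong (+-homo a c) (F.trans (F.*-congʳ (+-homo b d)) (F.distribʳ z (ι b) (ι d))))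
    (FiniteField.interchange F _ _ _ _)

  fromPair-0 : fromPair (0# , 0#) F.≈ F.0#
  fromPair-0 = F.trans (F.+-cong 0#-homo (F.trans (F.*-congʳ 0#-homo) (F.zeroˡ z))) (F.+-identityˡ F.0#)

  fromPair-coordinates : ∀ x → fromPair (coordinates x) F.≈ x
  fromPair-coordinates x = proj₂ (proj₂ (⟪⟫-surjective x))

  -- `coordinates` comes from an abstract surjectivity proof and does not compute. Linear
  -- independence of 1 and `z` identifies its values: any pair representing `x` must be the chosen
  -- one.
  coordinates-unique : ∀ x y → fromPair y F.≈ x → coordinates x ≋ y
  coordinates-unique x y eq =
    ⟪⟫-injective _ _ _ _ (F.trans (fromPair-coordinates x) (F.sym eq))

  coordinates-cong : ∀ {x y} → x F.≈ y → coordinates x ≋ coordinates y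
  coordinates-cong {x} {y} x≈y =
    coordinates-unique x (coordinates y) (F.trans (fromPair-coordinates y) (F.sym x≈y))

  coordinates-+ : ∀ x y → coordinates (x F.+ y) ≋ coordinates x ⊞ coordinates y
  coordinates-+ x y = coordinates-unique (x F.+ y) (coordinates x ⊞ coordinates y)
    (F.trans (fromPair-⊞ (coordinates x) (coordinates y))
             (F.+-cong (fromPair-coordinates x) (fromPair-coordinates y)))

  ≋0⇒≈0 : ∀ x → coordinates x ≋ (0# , 0#) → x F.≈ F.0#
  ≋0⇒≈0 x eq = F.trans (F.sym (fromPair-coordinates x)) (F.trans (fromPair-cong eq) fromPair-0)

-- The presemifield axioms, carried over from pairs to `F`.

theorem3 : ∀ {c₁ ℓ₁ c₂ ℓ₂ : Level} (m : ℕ) → m ≥ 1 →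
    (S : Setting c₁ ℓ₁ c₂ ℓ₂ m) → let open Setting S in
    (s : ℕ) → s < 2 ℕ.* m →
    (t : Quadruple L.Carrier) → Legitimate S s t → Quadruple.p₁ t L.≉ L.0# →
    (l : L.Carrier) → (l L.≈ L.0#) ⊎ ((l L.≉ L.0#) × ¬ IsPower[σ-1] S s l) →
    IsPresemifield (B S s l t) (2 ℕ.^ (2 ℕ.* m))
theorem3 m _ S s _ t legitimate p₁≉0 l l-cond = record
  -- Equality and addition of `B` are those of `F`, so the group structure and the order are
  -- inherited.
  { +-isAbelianGroup = F.+-isAbelianGroup
  ; order            = F.hasOrder
  ; *-cong           = λ {x} {x′} {y} {y′} x≈x′ y≈y′ → fromPair-cong
      (⊙-cong {coordinates x} {coordinates x′} {coordinates y} {coordinates y′}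
        (coordinates-cong x≈x′) (coordinates-cong y≈y′))
  ; distrib          = distribˡ , distribʳ
  ; noZeroDivisors   = noZeroDivisors
  }
  where
  open Setting S
  open Basis S using (coordinates; ⟪⟫-injective)
  open Multiplication S s t l
  open FiniteField F using (_≟_)

  infixl 7 _∘_
  _∘_ : F.Carrier → F.Carrier → F.Carrier
  x ∘ y = fromPair (coordinates x ⊙ coordinates y)

  distribˡ : ∀ x y w → x ∘ (y F.+ w) F.≈ x ∘ y F.+ x ∘ w
  distribˡ x y w = F.trans
    (fromPair-cong (⊙-cong {coordinates x} {coordinates x} {coordinates (y F.+ w)}
      (L.refl , L.refl) (coordinates-+ y w)))
    (F.trans (fromPair-cong (⊙-distribˡ-⊞ (coordinates x) (coordinates y) (coordinates w)))
             (fromPair-⊞ (coordinates x ⊙ coordinates y) (coordinates x ⊙ coordinates w)))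

  distribʳ : ∀ y x w → (x F.+ w) ∘ y F.≈ x ∘ y F.+ w ∘ y
  distribʳ y x w = F.trans
    (fromPair-cong (⊙-cong {coordinates (x F.+ w)} {_} {coordinates y} {coordinates y}
      (coordinates-+ x w) (L.refl , L.refl)))
    (F.trans (fromPair-cong (⊙-distribʳ-⊞ (coordinates y) (coordinates x) (coordinates w)))
             (fromPair-⊞ (coordinates x ⊙ coordinates y) (coordinates w ⊙ coordinates y)))

  noZeroDivisors : ∀ x y → x ∘ y F.≈ F.0# → x F.≈ F.0# ⊎ y F.≈ F.0#
  -- `⊙-nonzero` only refutes; the disjunction comes from deciding equality with zero in the finite
  -- field `F`.
  noZeroDivisors x y xy≈0 with x ≟ F.0# | y ≟ F.0#
  ... | yes x≈0 | _       = inj₁ x≈0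
  ... | no _    | yes y≈0 = inj₂ y≈0
  ... | no x≉0  | no y≉0  = ⊥-elim (⊙-nonzero legitimate p₁≉0 l-cond (coordinates x) (coordinates y)
    (λ eq → x≉0 (≋0⇒≈0 x eq)) (λ eq → y≉0 (≋0⇒≈0 y eq))
    -- Zero in `F` is represented by the zero pair, so both coordinates of the product vanish.
    (⟪⟫-injective _ _ _ _ (F.trans xy≈0 (F.sym fromPair-0))))
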